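{- Every $(0,3,6)$-fullerene is isomorphic to a Cayley sum graph for an abelian group which can be generated by two elements.
   Context: A semiedge of a graph is an edge with one endpoint; it contributes one to the valency of its endpoint and one to the corresponding diagonal entry of the adjacency matrix, and in a plane embedding it sits in a face and contributes one to that face's length. A $(0,3,6)$-fullerene is a cubic plane graph, possibly with semiedges, whose faces have sizes 3 and 6. For a finite additive abelian group $\Gamma$ and a (multi)set $S \subseteq \Gamma$, the Cayley sum graph $\mathrm{Cay}^+(\Gamma,S)$ has vertex set $\Gamma$, with $uv$ an edge if and only if $u+v\in S$ (a multiset $S$ gives multiple edges, and if $2u\in S$ the edge $uu$ is a semiedge). -}

module Defs where

open import Data.Nat using (ℕ; zero; suc; _+_; _<_)
open import Data.Fin using (Fin)
open import Data.Integer using (ℤ; +_; -[1+_])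
open import Data.Product using (Σ; ∃; ∃-syntax; _×_; _,_; proj₁)
open import Data.Sum using (_⊎_)
open import Relation.Binary.PropositionalEquality using (_≡_; _≢_)
open import Relation.Nullary using (¬_)
open import Function.Base using (_∘_)
open import Function.Bundles using (_⇔_)
open import Function.Definitions using (Injective; Bijective)
open import Algebra.Structures using (IsAbelianGroup)

iter : ∀ {A : Set} → (A → A) → ℕ → A → A
iter f zero    x = x
iter f (suc k) x = f (iter f k x)

SameOrbit : ∀ {n} → (Fin n → Fin n) → Fin n → Fin n → Set
SameOrbit f x y = ∃[ k ] iter f k x ≡ y

OrbitLength : ∀ {n} → (Fin n → Fin n) → Fin n → ℕ → Set
OrbitLength f x m =
  (0 < m) × (iter f m x ≡ x) × (∀ k → 0 < k → k < m → iter f k x ≢ x)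

HasOrbitCount : ∀ {n} → (Fin n → Fin n) → ℕ → Set
HasOrbitCount {n} f m =
  Σ (Fin m → Fin n) λ r →
    (∀ d → ∃[ i ] SameOrbit f (r i) d) ×
    (∀ i j → SameOrbit f (r i) (r j) → i ≡ j)

-- Combinatorial maps with semiedges (plane graphs via rotation systems)
--
-- Darts are Fin n.  σ is the rotation at vertices (vertices = σ-orbits),
-- α is the edge involution (edges = α-orbits; a fixed point of α is a
-- semiedge, a 2-orbit an ordinary edge, loop or multiple edge), and
-- faces are the orbits of φ = σ ∘ α; the length of a face is the size of
-- its φ-orbit (so a semiedge contributes one to the length of its face).

data Reach {n} (σ α : Fin n → Fin n) (x : Fin n) : Fin n → Set where
  here  : Reach σ α x x
  stepσ : ∀ {y} → Reach σ α x y → Reach σ α x (σ y)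
  stepα : ∀ {y} → Reach σ α x y → Reach σ α x (α y)

record Map (n : ℕ) : Set where
  field
    σ        : Fin n → Fin n
    α        : Fin n → Fin n
    σ-inj    : Injective _≡_ _≡_ σ
    α-invol  : ∀ d → α (α d) ≡ d
    connected : ∀ d d′ → Reach σ α d d′

  φ : Fin n → Fin n
  φ = σ ∘ α

open Map public

-- Genus 0 (plane) condition: Euler's formula V − E + F = 2, where E is
-- the number of ordinary edges (semiedges are contractible dangling
-- half-edges).  With A = #α-orbits and n = 2E + #semiedges we have
-- E = n − A, so the formula reads V + F + A = 2 + n.
IsPlane : ∀ {n} → Map n → Set
IsPlane {n} M =
  ∃[ V ] ∃[ F ] ∃[ A ]
    HasOrbitCount (σ M) V × HasOrbitCount (φ M) F × HasOrbitCount (α M) A ×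
    (V + F + A ≡ 2 + n)

IsCubic : ∀ {n} → Map n → Set
IsCubic M = ∀ d → OrbitLength (σ M) d 3

Is036Fullerene : ∀ {n} → Map n → Set
Is036Fullerene M =
  IsPlane M × IsCubic M ×
  (∀ d → OrbitLength (φ M) d 3 ⊎ OrbitLength (φ M) d 6)

record FinAbGroup (N : ℕ) : Set where
  field
    _+ᴳ_  : Fin N → Fin N → Fin N
    0ᴳ    : Fin N
    -ᴳ_   : Fin N → Fin N
    isAbelianGroup : IsAbelianGroup _≡_ _+ᴳ_ 0ᴳ -ᴳ_

open FinAbGroup public

_·ⁿ_ : ∀ {N} {G : FinAbGroup N} → ℕ → Fin N → Fin N
_·ⁿ_ {G = G} zero    x = 0ᴳ G
_·ⁿ_ {G = G} (suc k) x = _+ᴳ_ G x (_·ⁿ_ {G = G} k x)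

zmul : ∀ {N} (G : FinAbGroup N) → ℤ → Fin N → Fin N
zmul G (+ k)      x = _·ⁿ_ {G = G} k x
zmul G -[1+ k ]   x = -ᴳ_ G (_·ⁿ_ {G = G} (suc k) x)

GeneratedBy2 : ∀ {N} → FinAbGroup N → Fin N → Fin N → Set
GeneratedBy2 G a b = ∀ x → ∃[ i ] ∃[ j ] x ≡ _+ᴳ_ G (zmul G i a) (zmul G j b)

-- Cay⁺(G,S) for a multiset S given as S : Fin k → G, in dart form:
-- dart (u , i) is the end at u of the edge {u , S i − u} coming from the
-- i-th element of S; the edge involution sends (u , i) to (S i − u , i),
-- and (u , i) is a semiedge iff 2u = S i.
cayInvol : ∀ {N k} (G : FinAbGroup N) (S : Fin k → Fin N) →
           Fin N × Fin k → Fin N × Fin k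
cayInvol G S (u , i) = (_+ᴳ_ G (S i) (-ᴳ_ G u) , i)

IsoToCayleySum : ∀ {n N k} → Map n → (G : FinAbGroup N) → (Fin k → Fin N) → Set
IsoToCayleySum {n} {N} {k} M G S =
  Σ (Fin n → Fin N × Fin k) λ f →
    Bijective _≡_ _≡_ f ×
    (∀ d → f (α M d) ≡ cayInvol G S (f d)) ×
    (∀ d d′ → SameOrbit (σ M) d d′ ⇔ (proj₁ (f d) ≡ proj₁ (f d′)))

{-# OPTIONS --safe #-}

-- The rotations σ, α satisfy σ³ = α² = (σα)⁶ = 1, so the darts carry an action
-- of the rotation group Δ of the hexagonal lattice.  The half-turns
-- p₀ = α, p₁ = σ⁻¹ασ, p₂ = σασ⁻¹ satisfy (p₂p₁p₀)² = 1, hence the translations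
-- a = p₁p₀, b = p₀p₂, c = p₂p₁ commute, abc = 1, every pᵢ inverts them, and σ
-- permutes them cyclically.  Euler's formula forces a half-turn, α or (σα)³, to
-- fix some dart d₀.  The translation orbit O of d₀ is then stable under all pᵢ,
-- so every vertex carries a dart of O.  It carries only one: a rotation of order
-- three is conjugate to σ^±¹ or (σα)^±², and none of these has a fixed dart.  So
-- O is the vertex set, the translations make it an abelian group generated by a
-- and b, and since pᵢ inverts translations it acts on O as u ↦ pᵢ(0) − u.
module Submission where

open import Defs
open import Algebra.Bundles using (AbelianGroup)
open import Algebra.Consequences.Propositional using (comm∧idˡ⇒id; comm∧invʳ⇒inv)
import Algebra.Properties.CommutativeSemigroup as CommutativeSemigroupProperties
import Algebra.Properties.AbelianGroup as AbelianGroupProperties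
open import Data.Empty using (⊥; ⊥-elim)
open import Data.Fin using (Fin; zero; suc; toℕ; remQuot; combine)
open import Data.Fin.Properties using (any?; _≟_; injective⇒≤; toℕ<n; toℕ-injective; combine-remQuot)
open import Data.Integer using (ℤ; +_; -[1+_]) renaming (suc to sucℤ; pred to predℤ)
open import Data.Integer.Properties using (pred-suc)
open import Data.List using (List; []; _∷_; _++_)
open import Data.Nat using (ℕ; zero; suc; _+_; _*_; _∸_; _≤_; _<_; z≤n; s≤s)
open import Data.Nat.Properties using (+-comm; +-mono-≤; *-monoʳ-≤; <⇒≤; <-cmp; m∸n+n≡m; m<n⇒0<n∸m; m∸n≤m; <-≤-trans; ≤-<-trans; m≤n+m; <-irrefl)
open import Data.Nat.Tactic.RingSolver using (solve-∀)
open import Data.Product using (Σ; ∃; ∃-syntax; _×_; _,_; proj₁; proj₂)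
open import Data.Sum using (_⊎_; inj₁; inj₂)
open import Function.Bundles using (mk⇔)
open import Function.Definitions using (Injective)
open import Level using (0ℓ)
open import Relation.Binary.Definitions using (tri<; tri≈; tri>)
open import Relation.Binary.PropositionalEquality
open import Relation.Nullary using (yes; no)
open ≡-Reasoning

-- Counting orbits

iter-+ : ∀ {A : Set} (f : A → A) k l x → iter f (k + l) x ≡ iter f k (iter f l x)
iter-+ f zero    l x = refl
iter-+ f (suc k) l x = cong f (iter-+ f k l x)

iter-injective : ∀ {A : Set} {f : A → A} → Injective _≡_ _≡_ f →
                 ∀ k → Injective _≡_ _≡_ (iter f k)
iter-injective inj zero    eq = eq
iter-injective inj (suc k) eq = iter-injective inj k (inj eq)

module _ {n} {f : Fin n → Fin n} {k} (f-inj : Injective _≡_ _≡_ f)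
         (free : ∀ d → OrbitLength f d k) where

  private
    iter-distinct : ∀ {i j} x → i < j → j < k → iter f i x ≢ iter f j x
    iter-distinct {i} {j} x i<j j<k eq =
      proj₂ (proj₂ (free x)) (j ∸ i) (m<n⇒0<n∸m i<j) (≤-<-trans (m∸n≤m j i) j<k)
        (sym (iter-injective f-inj i (trans eq (trans (cong (λ l → iter f l x) j≡) (iter-+ f i _ x)))))
      where
      j≡ : j ≡ i + (j ∸ i)
      j≡ = sym (trans (+-comm i (j ∸ i)) (m∸n+n≡m (<⇒≤ i<j)))

  iter-injectiveˡ : ∀ {i j} x → i < k → j < k → iter f i x ≡ iter f j x → i ≡ j
  iter-injectiveˡ {i} {j} x i<k j<k eq with <-cmp i j
  ... | tri< i<j _ _ = ⊥-elim (iter-distinct x i<j j<k eq)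
  ... | tri≈ _ i≡j _ = i≡j
  ... | tri> _ _ j<i = ⊥-elim (iter-distinct x j<i i<k (sym eq))

  -- Distinct orbits are disjoint and each has `k` points, so the pairs (orbit, position in it)
  -- inject into the `n` points.
  orbitCount-≤ : ∀ {m} → HasOrbitCount f m → m * k ≤ n
  orbitCount-≤ {m} (r , _ , distinct) = injective⇒≤ {f = point} point-injective
    where
    at : Fin m × Fin k → Fin n
    at (i , j) = iter f (toℕ j) (r i)

    at-injective : ∀ {p q} → at p ≡ at q → p ≡ q
    at-injective {i , j} {i′ , j′} eq
      -- From the common point, `k ∸ toℕ j` further steps complete the turn back to `r i`; so `r i′`
      -- and `r i` share an orbit.
      with refl ← distinct i′ i (k ∸ toℕ j + toℕ j′ , (begin
        iter f (k ∸ toℕ j + toℕ j′) (r i′)          ≡⟨ iter-+ f (k ∸ toℕ j) _ _ ⟩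
        iter f (k ∸ toℕ j) (iter f (toℕ j′) (r i′)) ≡⟨ cong (iter f (k ∸ toℕ j)) eq ⟨
        iter f (k ∸ toℕ j) (iter f (toℕ j) (r i))   ≡⟨ iter-+ f (k ∸ toℕ j) _ _ ⟨
        iter f (k ∸ toℕ j + toℕ j) (r i)            ≡⟨ cong (λ l → iter f l (r i)) (m∸n+n≡m (<⇒≤ (toℕ<n j))) ⟩
        iter f k (r i)                              ≡⟨ proj₁ (proj₂ (free (r i))) ⟩
        r i                                         ∎))
      = cong (i ,_) (toℕ-injective (iter-injectiveˡ (r i) (toℕ<n j) (toℕ<n j′) eq))

    point : Fin (m * k) → Fin n
    point p = at (remQuot k p)

    point-injective : Injective _≡_ _≡_ point
    point-injective {p} {q} eq = begin
      p                           ≡⟨ combine-remQuot {m} k p ⟨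
      combine (proj₁ (remQuot {m} k p)) (proj₂ (remQuot {m} k p))
        ≡⟨ cong (λ pq → combine (proj₁ pq) (proj₂ pq)) (at-injective {remQuot k p} {remQuot k q} eq) ⟩
      combine (proj₁ (remQuot {m} k q)) (proj₂ (remQuot {m} k q))
        ≡⟨ combine-remQuot {m} k q ⟩
      q                           ∎

-- Euler's formula and a dart fixed by a half-turn

euler-bound : ∀ V F A n → V * 3 ≤ n → F * 6 ≤ n → A * 2 ≤ n → V + F + A ≢ 2 + n
euler-bound V F A n V≤ F≤ A≤ eq = <-irrefl refl (<-≤-trans n< n≥)
  where
  -- The weights 2, 1, 3 turn the three bounds into 6V + 6F + 6A ≤ 6n, whereas Euler's formula makes
  -- the left side 12 + 6n.
  regroup : ∀ V F A → 2 * (V * 3) + F * 6 + 3 * (A * 2) ≡ 6 * (V + F + A)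
  regroup = solve-∀

  total : ∀ n → 2 * n + n + 3 * n ≡ 6 * n
  total = solve-∀

  expand : ∀ n → 6 * (2 + n) ≡ 12 + 6 * n
  expand = solve-∀

  n≥ : 12 + 6 * n ≤ 6 * n
  n≥ = subst₂ _≤_ (trans (regroup V F A) (trans (cong (6 *_) eq) (expand n))) (total n)
         (+-mono-≤ (+-mono-≤ (*-monoʳ-≤ 2 V≤) F≤) (*-monoʳ-≤ 3 A≤))

  n< : 6 * n < 12 + 6 * n
  n< = s≤s (m≤n+m (6 * n) 11)

module _ {n} (M : Map n) (fullerene : Is036Fullerene M) where

  private
    s t : Fin n → Fin n
    s = σ M
    t = α M

    planar = proj₁ fullerene
    cubic = proj₁ (proj₂ fullerene)
    faces = proj₂ (proj₂ fullerene)

  α-injective : Injective _≡_ _≡_ t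
  α-injective {d} {d′} eq = trans (sym (α-invol M d)) (trans (cong t eq) (α-invol M d′))

  φ-injective : Injective _≡_ _≡_ (φ M)
  φ-injective eq = α-injective (σ-inj M eq)

  -- Since `φ⁶` is the identity, `φ³` acts as the half-turn about a face centre. The alternatives
  -- say that `d` is a semiedge or lies on a triangle.
  HalfTurnFixed : Fin n → Set
  HalfTurnFixed d = t d ≡ d ⊎ iter (φ M) 3 d ≡ d

  -- Without semiedges and triangles all orbits of `α` have length 2 and all faces length 6, which
  -- `euler-bound` excludes.
  halfTurnFixed : ∃ HalfTurnFixed
  halfTurnFixed with any? (λ d → t d ≟ d) | any? (λ d → iter (φ M) 3 d ≟ d)
  ... | yes (d , eq) | _            = d , inj₁ eq
  ... | no _         | yes (d , eq) = d , inj₂ eq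
  ... | no noSemi    | no noTriangle =
    let V , F , A , hV , hF , hA , eq = planar in
    ⊥-elim (euler-bound V F A n
      (orbitCount-≤ (σ-inj M) cubic hV)
      (orbitCount-≤ φ-injective hexagon hF)
      (orbitCount-≤ α-injective edge hA) eq)
    where
    hexagon : ∀ d → OrbitLength (φ M) d 6
    hexagon d with faces d
    ... | inj₁ (_ , eq , _) = ⊥-elim (noTriangle (d , eq))
    ... | inj₂ six          = six

    edge : ∀ d → OrbitLength t d 2
    edge d = s≤s z≤n , α-invol M d , λ where
      (suc zero) _ _ eq → noSemi (d , eq)
      (suc (suc _)) _ (s≤s (s≤s ()))

  φ⁶ : ∀ d → iter (φ M) 6 d ≡ d
  φ⁶ d with faces d
  ... | inj₁ (_ , eq , _) = trans (cong (iter (φ M) 3) eq) eq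
  ... | inj₂ (_ , eq , _) = eq

  -- `φ²` acts as the rotation of order three about a face centre; 2 is less than both admissible
  -- face lengths.
  φ²-free : ∀ d → iter (φ M) 2 d ≢ d
  φ²-free d with faces d
  ... | inj₁ (_ , _ , free) = free 2 (s≤s z≤n) (s≤s (s≤s (s≤s z≤n)))
  ... | inj₂ (_ , _ , free) = free 2 (s≤s z≤n) (s≤s (s≤s (s≤s z≤n)))

  σ³ : ∀ d → s (s (s d)) ≡ d
  σ³ d = proj₁ (proj₂ (cubic d))

  σ-free : ∀ d → s d ≢ d
  σ-free d = proj₂ (proj₂ (cubic d)) 1 (s≤s z≤n) (s≤s (s≤s z≤n))

-- Half-turns and translations

-- As abc = 1, having `c` as a third letter makes every inverse a word without formal inverses, and
-- conjugation by σ permutes the letters.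
data Letter : Set where
  a b c : Letter

Word : Set
Word = List Letter

module HexagonalAction {D : Set} (σ α : D → D)
         (σ³ : ∀ d → σ (σ (σ d)) ≡ d) (α² : ∀ d → α (α d) ≡ d)
         (φ⁶ : ∀ d → iter (λ e → σ (α e)) 6 d ≡ d) where

  p₀ p₁ p₂ : D → D
  p₀ = α
  p₁ d = σ (σ (α (σ d)))
  p₂ d = σ (α (σ (σ d)))

  p₁² : ∀ d → p₁ (p₁ d) ≡ d
  p₁² d = begin
    σ (σ (α (σ (σ (σ (α (σ d))))))) ≡⟨ cong (λ e → σ (σ (α e))) (σ³ _) ⟩
    σ (σ (α (α (σ d))))             ≡⟨ cong (λ e → σ (σ e)) (α² _) ⟩
    σ (σ (σ d))                     ≡⟨ σ³ d ⟩
    d                               ∎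

  p₂² : ∀ d → p₂ (p₂ d) ≡ d
  p₂² d = begin
    σ (α (σ (σ (σ (α (σ (σ d))))))) ≡⟨ cong (λ e → σ (α e)) (σ³ _) ⟩
    σ (α (α (σ (σ d))))             ≡⟨ cong σ (α² _) ⟩
    σ (σ (σ d))                     ≡⟨ σ³ d ⟩
    d                               ∎

  φ³≡p₂p₁p₀ : ∀ d → iter (λ e → σ (α e)) 3 d ≡ p₂ (p₁ (p₀ d))
  φ³≡p₂p₁p₀ d = cong (λ e → σ (α e)) (sym (σ³ _))

  -- The product p₂p₁p₀ is φ³, an involution by `φ⁶`, and so equals its inverse. All commutation
  -- below comes from this relation.
  p₂p₁p₀≡p₀p₁p₂ : ∀ d → p₂ (p₁ (p₀ d)) ≡ p₀ (p₁ (p₂ d))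
  p₂p₁p₀≡p₀p₁p₂ d = begin
    p₂ (p₁ (p₀ d))                               ≡⟨ α² _ ⟨
    p₀ (p₀ (p₂ (p₁ (p₀ d))))                     ≡⟨ cong p₀ (p₁² _) ⟨
    p₀ (p₁ (p₁ (p₀ (p₂ (p₁ (p₀ d))))))           ≡⟨ cong (λ e → p₀ (p₁ e)) (p₂² _) ⟨
    p₀ (p₁ (p₂ (p₂ (p₁ (p₀ (p₂ (p₁ (p₀ d)))))))) ≡⟨ cong (λ e → p₀ (p₁ (p₂ e))) square ⟩
    p₀ (p₁ (p₂ d))                               ∎
    where
    square : p₂ (p₁ (p₀ (p₂ (p₁ (p₀ d))))) ≡ d
    square = begin
      p₂ (p₁ (p₀ (p₂ (p₁ (p₀ d)))))            ≡⟨ φ³≡p₂p₁p₀ _ ⟨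
      iter (λ e → σ (α e)) 3 (p₂ (p₁ (p₀ d)))  ≡⟨ cong (iter (λ e → σ (α e)) 3) (φ³≡p₂p₁p₀ d) ⟨
      iter (λ e → σ (α e)) 6 d                 ≡⟨ φ⁶ d ⟩
      d                                        ∎

  p₀p₂p₁≡p₁p₂p₀ : ∀ d → p₀ (p₂ (p₁ d)) ≡ p₁ (p₂ (p₀ d))
  p₀p₂p₁≡p₁p₂p₀ d = begin
    p₀ (p₂ (p₁ d))           ≡⟨ cong (λ e → p₀ (p₂ (p₁ e))) (α² d) ⟨
    p₀ (p₂ (p₁ (p₀ (p₀ d)))) ≡⟨ cong p₀ (p₂p₁p₀≡p₀p₁p₂ _) ⟩
    p₀ (p₀ (p₁ (p₂ (p₀ d)))) ≡⟨ α² _ ⟩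
    p₁ (p₂ (p₀ d))           ∎

  ⟦_⟧ : Letter → D → D
  ⟦ a ⟧ d = p₁ (p₀ d)
  ⟦ b ⟧ d = p₀ (p₂ d)
  ⟦ c ⟧ d = p₂ (p₁ d)

  act : Word → D → D
  act []      d = d
  act (l ∷ w) d = ⟦ l ⟧ (act w d)

  abc : ∀ d → ⟦ a ⟧ (⟦ b ⟧ (⟦ c ⟧ d)) ≡ d
  abc d = trans (cong p₁ (α² _)) (trans (cong p₁ (p₂² _)) (p₁² d))

  bca : ∀ d → ⟦ b ⟧ (⟦ c ⟧ (⟦ a ⟧ d)) ≡ d
  bca d = trans (cong p₀ (p₂² _)) (trans (cong p₀ (p₁² _)) (α² d))

  cab : ∀ d → ⟦ c ⟧ (⟦ a ⟧ (⟦ b ⟧ d)) ≡ d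
  cab d = trans (cong p₂ (p₁² _)) (trans (cong p₂ (α² _)) (p₂² d))

  -- Both sides equal p₁p₂: in ab two adjacent p₀ cancel, and in ba they become adjacent once p₂p₁p₀
  -- is reversed.
  ab≡ba : ∀ d → ⟦ a ⟧ (⟦ b ⟧ d) ≡ ⟦ b ⟧ (⟦ a ⟧ d)
  ab≡ba d = begin
    p₁ (p₀ (p₀ (p₂ d))) ≡⟨ cong p₁ (α² _) ⟩
    p₁ (p₂ d)           ≡⟨ α² _ ⟨
    p₀ (p₀ (p₁ (p₂ d))) ≡⟨ cong p₀ (p₂p₁p₀≡p₀p₁p₂ d) ⟨
    p₀ (p₂ (p₁ (p₀ d))) ∎

  -- Inserting cab = 1 reduces this to the commutation of a and b: ac = ca(ba)c = ca(ab)c = ca(abc)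
  -- = ca.
  ac≡ca : ∀ d → ⟦ a ⟧ (⟦ c ⟧ d) ≡ ⟦ c ⟧ (⟦ a ⟧ d)
  ac≡ca d = begin
    ⟦ a ⟧ (⟦ c ⟧ d)                                 ≡⟨ cab _ ⟨
    ⟦ c ⟧ (⟦ a ⟧ (⟦ b ⟧ (⟦ a ⟧ (⟦ c ⟧ d))))         ≡⟨ cong (λ e → ⟦ c ⟧ (⟦ a ⟧ e)) (ab≡ba _) ⟨
    ⟦ c ⟧ (⟦ a ⟧ (⟦ a ⟧ (⟦ b ⟧ (⟦ c ⟧ d))))         ≡⟨ cong (λ e → ⟦ c ⟧ (⟦ a ⟧ e)) (abc d) ⟩
    ⟦ c ⟧ (⟦ a ⟧ d)                                 ∎

  bc≡cb : ∀ d → ⟦ b ⟧ (⟦ c ⟧ d) ≡ ⟦ c ⟧ (⟦ b ⟧ d)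
  bc≡cb d = begin
    ⟦ b ⟧ (⟦ c ⟧ d)                                 ≡⟨ cab _ ⟨
    ⟦ c ⟧ (⟦ a ⟧ (⟦ b ⟧ (⟦ b ⟧ (⟦ c ⟧ d))))         ≡⟨ cong ⟦ c ⟧ (ab≡ba _) ⟩
    ⟦ c ⟧ (⟦ b ⟧ (⟦ a ⟧ (⟦ b ⟧ (⟦ c ⟧ d))))         ≡⟨ cong (λ e → ⟦ c ⟧ (⟦ b ⟧ e)) (abc d) ⟩
    ⟦ c ⟧ (⟦ b ⟧ d)                                 ∎

  letters-comm : ∀ l m d → ⟦ l ⟧ (⟦ m ⟧ d) ≡ ⟦ m ⟧ (⟦ l ⟧ d)
  letters-comm a a d = refl
  letters-comm a b d = ab≡ba d
  letters-comm a c d = ac≡ca d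
  letters-comm b a d = sym (ab≡ba d)
  letters-comm b b d = refl
  letters-comm b c d = bc≡cb d
  letters-comm c a d = sym (ac≡ca d)
  letters-comm c b d = sym (bc≡cb d)
  letters-comm c c d = refl

  letter-act : ∀ l w d → ⟦ l ⟧ (act w d) ≡ act w (⟦ l ⟧ d)
  letter-act l []      d = refl
  letter-act l (m ∷ w) d = trans (letters-comm l m _) (cong ⟦ m ⟧ (letter-act l w d))

  act-comm : ∀ v w d → act v (act w d) ≡ act w (act v d)
  act-comm []      w d = refl
  act-comm (l ∷ v) w d = trans (cong ⟦ l ⟧ (act-comm v w d)) (letter-act l w _)

  act-++ : ∀ v w d → act (v ++ w) d ≡ act v (act w d)
  act-++ []      w d = refl
  act-++ (l ∷ v) w d = cong ⟦ l ⟧ (act-++ v w d)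

  -- From abc = 1 and its cyclic shifts, a⁻¹ = bc, b⁻¹ = ca and c⁻¹ = ab. The order of the letters
  -- is kept, as translations commute.
  inverse : Word → Word
  inverse []      = []
  inverse (a ∷ w) = b ∷ c ∷ inverse w
  inverse (b ∷ w) = c ∷ a ∷ inverse w
  inverse (c ∷ w) = a ∷ b ∷ inverse w

  act-inverse : ∀ w d → act w (act (inverse w) d) ≡ d
  act-inverse []      d = refl
  act-inverse (a ∷ w) d = begin
    ⟦ a ⟧ (act w (⟦ b ⟧ (⟦ c ⟧ e)))  ≡⟨ cong ⟦ a ⟧ (letter-act b w _) ⟨
    ⟦ a ⟧ (⟦ b ⟧ (act w (⟦ c ⟧ e)))  ≡⟨ cong (λ x → ⟦ a ⟧ (⟦ b ⟧ x)) (letter-act c w _) ⟨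
    ⟦ a ⟧ (⟦ b ⟧ (⟦ c ⟧ (act w e)))  ≡⟨ abc _ ⟩
    act w e                          ≡⟨ act-inverse w d ⟩
    d                                ∎
    where e = act (inverse w) d
  act-inverse (b ∷ w) d = begin
    ⟦ b ⟧ (act w (⟦ c ⟧ (⟦ a ⟧ e)))  ≡⟨ cong ⟦ b ⟧ (letter-act c w _) ⟨
    ⟦ b ⟧ (⟦ c ⟧ (act w (⟦ a ⟧ e)))  ≡⟨ cong (λ x → ⟦ b ⟧ (⟦ c ⟧ x)) (letter-act a w _) ⟨
    ⟦ b ⟧ (⟦ c ⟧ (⟦ a ⟧ (act w e)))  ≡⟨ bca _ ⟩
    act w e                          ≡⟨ act-inverse w d ⟩
    d                                ∎
    where e = act (inverse w) d
  act-inverse (c ∷ w) d = begin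
    ⟦ c ⟧ (act w (⟦ a ⟧ (⟦ b ⟧ e)))  ≡⟨ cong ⟦ c ⟧ (letter-act a w _) ⟨
    ⟦ c ⟧ (⟦ a ⟧ (act w (⟦ b ⟧ e)))  ≡⟨ cong (λ x → ⟦ c ⟧ (⟦ a ⟧ x)) (letter-act b w _) ⟨
    ⟦ c ⟧ (⟦ a ⟧ (⟦ b ⟧ (act w e)))  ≡⟨ cab _ ⟩
    act w e                          ≡⟨ act-inverse w d ⟩
    d                                ∎
    where e = act (inverse w) d

  p₀-act : ∀ w d → p₀ (act w d) ≡ act (inverse w) (p₀ d)
  p₀-act []      d = refl
  p₀-act (a ∷ w) d = begin
    p₀ (p₁ (p₀ (act w d)))                     ≡⟨ cong p₀ (p₂² _) ⟨
    ⟦ b ⟧ (⟦ c ⟧ (p₀ (act w d)))               ≡⟨ cong (λ e → ⟦ b ⟧ (⟦ c ⟧ e)) (p₀-act w d) ⟩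
    ⟦ b ⟧ (⟦ c ⟧ (act (inverse w) (p₀ d)))     ∎
  p₀-act (b ∷ w) d = begin
    p₀ (p₀ (p₂ (act w d)))                     ≡⟨ α² _ ⟩
    p₂ (act w d)                               ≡⟨ cong p₂ (α² _) ⟨
    p₂ (p₀ (p₀ (act w d)))                     ≡⟨ cong p₂ (p₁² _) ⟨
    ⟦ c ⟧ (⟦ a ⟧ (p₀ (act w d)))               ≡⟨ cong (λ e → ⟦ c ⟧ (⟦ a ⟧ e)) (p₀-act w d) ⟩
    ⟦ c ⟧ (⟦ a ⟧ (act (inverse w) (p₀ d)))     ∎
  p₀-act (c ∷ w) d = begin
    -- For `a` and `b`, which contain p₀, inserting or cancelling squares suffices; `c` needs the
    -- relation between all three half-turns.
    p₀ (p₂ (p₁ (act w d)))                     ≡⟨ p₀p₂p₁≡p₁p₂p₀ _ ⟩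
    p₁ (p₂ (p₀ (act w d)))                     ≡⟨ cong p₁ (α² _) ⟨
    ⟦ a ⟧ (⟦ b ⟧ (p₀ (act w d)))               ≡⟨ cong (λ e → ⟦ a ⟧ (⟦ b ⟧ e)) (p₀-act w d) ⟩
    ⟦ a ⟧ (⟦ b ⟧ (act (inverse w) (p₀ d)))     ∎

  -- halfTurn k = σᵏ α σ⁻ᵏ
  halfTurn : Fin 3 → D → D
  halfTurn zero             = p₀
  halfTurn (suc zero)       = p₂
  halfTurn (suc (suc zero)) = p₁

  -- Two half-turns differ by a translation: p₂ = (p₂p₁)(p₁p₀)p₀ = ca p₀ and p₁ = a p₀. This reduces
  -- claims about all half-turns to `p₀`.
  fromP₀ : Fin 3 → Word
  fromP₀ zero             = []
  fromP₀ (suc zero)       = c ∷ a ∷ []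
  fromP₀ (suc (suc zero)) = a ∷ []

  halfTurn≡ : ∀ k d → halfTurn k d ≡ act (fromP₀ k) (p₀ d)
  halfTurn≡ zero             d = refl
  halfTurn≡ (suc zero)       d = sym (trans (cong p₂ (p₁² _)) (cong p₂ (α² d)))
  halfTurn≡ (suc (suc zero)) d = sym (cong p₁ (α² d))

  halfTurn-act : ∀ k w d → halfTurn k (act w d) ≡ act (inverse w) (halfTurn k d)
  halfTurn-act k w d = begin
    halfTurn k (act w d)                        ≡⟨ halfTurn≡ k _ ⟩
    act (fromP₀ k) (p₀ (act w d))               ≡⟨ cong (act (fromP₀ k)) (p₀-act w d) ⟩
    act (fromP₀ k) (act (inverse w) (p₀ d))     ≡⟨ act-comm (fromP₀ k) (inverse w) _ ⟩
    act (inverse w) (act (fromP₀ k) (p₀ d))     ≡⟨ cong (act (inverse w)) (halfTurn≡ k d) ⟨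
    act (inverse w) (halfTurn k d)              ∎

  -- This is why an edge gets the same index at both ends: where σᵏ brings `d` into an orbit stable
  -- under half-turns, it brings `α d` there too.
  σ^-α : ∀ k d → iter σ (toℕ k) (α d) ≡ halfTurn k (iter σ (toℕ k) d)
  σ^-α zero             d = refl
  σ^-α (suc zero)       d = cong (λ e → σ (α e)) (sym (σ³ d))
  σ^-α (suc (suc zero)) d = cong (λ e → σ (σ (α e))) (sym (σ³ d))

  -- Fixed darts of rotations of order three

  rotate : Letter → Letter
  rotate a = c
  rotate b = a
  rotate c = b

  letter-σ : ∀ l d → ⟦ l ⟧ (σ d) ≡ σ (⟦ rotate l ⟧ d)
  letter-σ a d = cong (λ e → σ (σ (α e))) (sym (cong σ (σ³ _)))
  letter-σ b d = trans (cong (λ e → α (σ (α e))) (σ³ d)) (sym (σ³ _))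
  letter-σ c d = cong (λ e → σ (α e)) (σ³ _)

  module RotationFree (σ-free : ∀ d → σ d ≢ d) (φ²-free : ∀ d → iter (λ e → σ (α e)) 2 d ≢ d) where

    Free : Word → Set
    Free w = ∀ d → σ (act w d) ≢ d

    -- Conjugation by l turns σ l w into σ (rotate l) w, so only the length of w,
    -- modulo 3 because abc = 1, matters.
    conjugate : ∀ l w → Free (rotate l ∷ w) → Free (l ∷ w)
    conjugate l w free d eq = free (⟦ l ⟧ d) (begin
      σ (⟦ rotate l ⟧ (act w (⟦ l ⟧ d))) ≡⟨ letter-σ l _ ⟨
      ⟦ l ⟧ (σ (act w (⟦ l ⟧ d)))        ≡⟨ cong (λ e → ⟦ l ⟧ (σ e)) (letter-act l w d) ⟨
      ⟦ l ⟧ (σ (⟦ l ⟧ (act w d)))        ≡⟨ cong ⟦ l ⟧ eq ⟩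
      ⟦ l ⟧ d                            ∎)

    conjugate² : ∀ l w → Free (rotate (rotate l) ∷ w) → Free (l ∷ w)
    conjugate² l w free = conjugate l w (conjugate (rotate l) w free)

    -- `rotate` is a 3-cycle on the letters, so at most two conjugations turn one letter into any
    -- other.
    recolour : ∀ l m w → Free (m ∷ w) → Free (l ∷ w)
    recolour a a w = λ free → free
    recolour a b w = conjugate² a w
    recolour a c w = conjugate a w
    recolour b a w = conjugate b w
    recolour b b w = λ free → free
    recolour b c w = conjugate² b w
    recolour c a w = conjugate² c w
    recolour c b w = conjugate c w
    recolour c c w = λ free → free

    swap : ∀ l m w → Free (m ∷ l ∷ w) → Free (l ∷ m ∷ w)
    swap l m w free d eq = free d (trans (cong σ (letters-comm m l _)) eq)

    -- Here σa = ασα, a conjugate of σ.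
    a-free : Free (a ∷ [])
    a-free d eq = σ-free (α d) (begin
      σ (α d)               ≡⟨ α² _ ⟨
      α (α (σ (α d)))       ≡⟨ cong α (σ³ _) ⟨
      α (σ (⟦ a ⟧ d))       ≡⟨ cong α eq ⟩
      α d                   ∎)

    -- Here σab = ασ⁻¹ασ⁻¹, the inverse of φ².
    ab-free : Free (a ∷ b ∷ [])
    ab-free d eq = φ²-free d (begin
      σ (α (σ (α d)))                                 ≡⟨ cong (λ e → σ (α (σ (α e)))) inv ⟨
      σ (α (σ (α (α (σ (σ (α (σ (σ d)))))))))         ≡⟨ cong (λ e → σ (α (σ e))) (α² _) ⟩
      σ (α (σ (σ (σ (α (σ (σ d)))))))                 ≡⟨ p₂² d ⟩
      d                                               ∎)
      where
      inv : α (σ (σ (α (σ (σ d))))) ≡ d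
      inv = begin
        α (σ (σ (α (σ (σ d)))))    ≡⟨ σ³ _ ⟨
        σ (p₁ (p₂ d))              ≡⟨ cong (λ e → σ (p₁ e)) (α² _) ⟨
        σ (⟦ a ⟧ (⟦ b ⟧ d))        ≡⟨ eq ⟩
        d                          ∎

    rotation-free : ∀ w → Free w
    rotation-free []              = σ-free
    rotation-free (l ∷ [])        = recolour l a [] a-free
    rotation-free (l ∷ m ∷ [])    =
      recolour l a (m ∷ []) (swap a m [] (recolour m b (a ∷ []) (swap b a [] ab-free)))
    -- Only the head can be recoloured, so each of the three letters is brought to the front in
    -- turn. They become c, a, b, whose product is the identity, and the induction continues with
    -- `w`.
    rotation-free (l ∷ m ∷ n ∷ w) =
      recolour l b (m ∷ n ∷ w) (swap b m (n ∷ w) (recolour m a (b ∷ n ∷ w) λ d eq →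
        recolour n c (a ∷ b ∷ w)
          (λ e eq′ → rotation-free w e (trans (cong σ (sym (cab _))) eq′)) d
          (trans (cong σ (trans (letters-comm n a _) (cong ⟦ a ⟧ (letters-comm n b _)))) eq)))

-- The group of translations

toAbelianGroup : ∀ {N} → FinAbGroup N → AbelianGroup 0ℓ 0ℓ
toAbelianGroup G = record { isAbelianGroup = isAbelianGroup G }

module _ {N} (G : FinAbGroup N) where

  private
    open AbelianGroup (toAbelianGroup G) using (_∙_; _⁻¹; assoc; identityˡ; identityʳ; inverseʳ; inverseˡ)
    open AbelianGroupProperties (toAbelianGroup G) using (⁻¹-∙-comm)

    cancelˡ : ∀ x y → x ⁻¹ ∙ (x ∙ y) ≡ y
    cancelˡ x y = trans (sym (assoc _ x y)) (trans (cong (_∙ y) (inverseˡ x)) (identityˡ y))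

    cancelˡ′ : ∀ x y → x ∙ (x ⁻¹ ∙ y) ≡ y
    cancelˡ′ x y = trans (sym (assoc x _ y)) (trans (cong (_∙ y) (inverseʳ x)) (identityˡ y))

  zmul-pred : ∀ z x → zmul G (predℤ z) x ≡ x ⁻¹ ∙ zmul G z x
  zmul-pred (+ zero)  x = trans (cong _⁻¹ (identityʳ x)) (sym (identityʳ _))
  zmul-pred (+ suc k) x = sym (cancelˡ x _)
  zmul-pred -[1+ k ]  x = sym (⁻¹-∙-comm x _)

  -- `predℤ` undoes `sucℤ`, so the case analysis on the sign is done once, in `zmul-pred`.
  zmul-suc : ∀ z x → zmul G (sucℤ z) x ≡ x ∙ zmul G z x
  zmul-suc z x = begin
    zmul G (sucℤ z) x                ≡⟨ cancelˡ′ x _ ⟨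
    x ∙ (x ⁻¹ ∙ zmul G (sucℤ z) x)   ≡⟨ cong (x ∙_) (zmul-pred (sucℤ z) x) ⟨
    x ∙ zmul G (predℤ (sucℤ z)) x    ≡⟨ cong (λ y → x ∙ zmul G y x) (pred-suc z) ⟩
    x ∙ zmul G z x                   ∎

module _ {n} (M : Map n) (fullerene : Is036Fullerene M) where

  private
    s t : Fin n → Fin n
    s = σ M
    t = α M

    V : ℕ
    V = proj₁ (proj₁ fullerene)

    vertices : HasOrbitCount s V
    vertices = proj₁ (proj₂ (proj₂ (proj₂ (proj₁ fullerene))))

    r : Fin V → Fin n
    r = proj₁ vertices

    -- The future zero of the group. Being fixed by a half-turn is what keeps its translation orbit
    -- stable under `α`.
    d₀ : Fin n
    d₀ = proj₁ (halfTurnFixed M fullerene)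

    s³ : ∀ d → s (s (s d)) ≡ d
    s³ = σ³ M fullerene

  open HexagonalAction s t s³ (α-invol M) (φ⁶ M fullerene)
  open RotationFree (σ-free M fullerene) (φ²-free M fullerene)

  -- The translation orbit meets every vertex exactly once

  InOrbit : Fin n → Set
  InOrbit d = ∃[ w ] act w d₀ ≡ d

  act-InOrbit : ∀ w {d} → InOrbit d → InOrbit (act w d)
  act-InOrbit w (v , eq) = w ++ v , trans (act-++ w v d₀) (cong (act w) eq)

  p₀-InOrbit : InOrbit (p₀ d₀)
  p₀-InOrbit with proj₂ (halfTurnFixed M fullerene)
  ... | inj₁ eq = [] , sym eq
  -- With φ³ fixing `d₀`, p₀ d₀ = p₀φ³ d₀ = p₀p₂p₁p₀ d₀ = ba d₀.
  ... | inj₂ eq = b ∷ a ∷ [] , cong p₀ (trans (sym (φ³≡p₂p₁p₀ d₀)) eq)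

  halfTurn-InOrbit : ∀ k → InOrbit (halfTurn k d₀)
  halfTurn-InOrbit k = subst InOrbit (sym (halfTurn≡ k d₀)) (act-InOrbit (fromP₀ k) p₀-InOrbit)

  -- Induction along a path from `d₀`. Crossing an edge keeps the index `k`, because the half-turn
  -- of index `k` maps the orbit to itself.
  cover : ∀ {d} → Reach s t d₀ d → ∃[ k ] InOrbit (iter s (toℕ {3} k) d)
  cover here = zero , [] , refl
  cover (stepσ {d} p) with cover p
  -- Passing from `d` to `s d` lowers the index by one modulo 3, so 0 wraps around to 2.
  ... | zero           , w , eq = suc (suc zero) , w , trans eq (sym (s³ d))
  ... | suc zero       , orbit  = zero , orbit
  ... | suc (suc zero) , orbit  = suc zero , orbit
  cover (stepα {d} p) =
    let k , w , eq = cover p in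
    k , subst InOrbit
          (trans (sym (halfTurn-act k w d₀)) (trans (cong (halfTurn k) eq) (sym (σ^-α k d))))
          (act-InOrbit (inverse w) (halfTurn-InOrbit k))

  -- If d = w d₀ and σd = w′ d₀, then the order-three rotation σww′⁻¹ fixes σd, against
  -- `rotation-free`.
  InOrbit-σ : ∀ {d} → InOrbit d → InOrbit (s d) → ⊥
  InOrbit-σ {d} (w , eq) (w′ , eq′) = rotation-free (w ++ inverse w′) (s d) (cong s (begin
    act (w ++ inverse w′) (s d)          ≡⟨ act-++ w (inverse w′) _ ⟩
    act w (act (inverse w′) (s d))       ≡⟨ cong (λ e → act w (act (inverse w′) e)) eq′ ⟨
    act w (act (inverse w′) (act w′ d₀)) ≡⟨ cong (act w) (act-comm (inverse w′) w′ d₀) ⟩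
    act w (act w′ (act (inverse w′) d₀)) ≡⟨ cong (act w) (act-inverse w′ d₀) ⟩
    act w d₀                             ≡⟨ eq ⟩
    d                                    ∎))

  iter-σ-mod3 : ∀ k d → ∃[ j ] iter s k d ≡ iter s (toℕ {3} j) d
  iter-σ-mod3 zero    d = zero , refl
  iter-σ-mod3 (suc k) d with iter-σ-mod3 k d
  ... | zero           , eq = suc zero , cong s eq
  ... | suc zero       , eq = suc (suc zero) , cong s eq
  ... | suc (suc zero) , eq = zero , trans (cong s eq) (s³ d)

  σ-orbit-trans : ∀ {d e f} → SameOrbit s d e → SameOrbit s e f → SameOrbit s d f
  σ-orbit-trans {d} (k , eq) (l , eq′) =
    l + k , trans (iter-+ s l k d) (trans (cong (iter s l) eq) eq′)

  σ-orbit-sym : ∀ {d e} → SameOrbit s d e → SameOrbit s e d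
  σ-orbit-sym {d} (k , eq) with iter-σ-mod3 k d
  ... | zero           , eq′ = 0 , trans (sym eq) eq′
  ... | suc zero       , eq′ = 2 , trans (cong (iter s 2) (trans (sym eq) eq′)) (s³ d)
  ... | suc (suc zero) , eq′ = 1 , trans (cong s (trans (sym eq) eq′)) (s³ d)

  InOrbit-unique : ∀ {d e} → InOrbit d → InOrbit e → SameOrbit s d e → d ≡ e
  InOrbit-unique {d} {e} p q (k , eq) with iter-σ-mod3 k d
  ... | zero           , eq′ = trans (sym eq′) eq
  ... | suc zero       , eq′ = ⊥-elim (InOrbit-σ p (subst InOrbit (trans (sym eq) eq′) q))
  ... | suc (suc zero) , eq′ =
    ⊥-elim (InOrbit-σ q (subst InOrbit (sym (trans (cong s (trans (sym eq) eq′)) (s³ d))) p))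

  vertex : Fin n → Fin V
  vertex d = proj₁ (proj₁ (proj₂ vertices) d)

  vertex-orbit : ∀ d → SameOrbit s (r (vertex d)) d
  vertex-orbit d = proj₂ (proj₁ (proj₂ vertices) d)

  orbit⇒vertex : ∀ {d e} → SameOrbit s d e → vertex d ≡ vertex e
  orbit⇒vertex {d} {e} so = proj₂ (proj₂ vertices) _ _
    (σ-orbit-trans (vertex-orbit d) (σ-orbit-trans so (σ-orbit-sym (vertex-orbit e))))

  vertex⇒orbit : ∀ {d e} → vertex d ≡ vertex e → SameOrbit s d e
  vertex⇒orbit {d} {e} eq = σ-orbit-trans (σ-orbit-sym (vertex-orbit d))
    (subst (λ v → SameOrbit s (r v) e) (sym eq) (vertex-orbit e))

  -- The index of the connection element to which the edge of `d` will belong. It is well determined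
  -- by `shift-unique`.
  shift : Fin n → Fin 3
  shift d = proj₁ (cover (connected M d₀ d))

  base : Fin n → Fin n
  base d = iter s (toℕ (shift d)) d

  base-InOrbit : ∀ d → InOrbit (base d)
  base-InOrbit d = proj₂ (cover (connected M d₀ d))

  base-orbit : ∀ d → SameOrbit s d (base d)
  base-orbit d = toℕ (shift d) , refl

  shift-unique : ∀ {d} k → InOrbit (iter s (toℕ k) d) → shift d ≡ k
  shift-unique {d} k p = toℕ-injective (iter-injectiveˡ (σ-inj M) (proj₁ (proj₂ fullerene)) d
    (toℕ<n (shift d)) (toℕ<n k)
    (InOrbit-unique (base-InOrbit d) p
      (σ-orbit-trans (σ-orbit-sym (base-orbit d)) (toℕ k , refl))))

  dart : Fin V → Fin n
  dart v = base (r v)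

  dart-vertex : ∀ d → dart (vertex d) ≡ base d
  dart-vertex d = InOrbit-unique (base-InOrbit _) (base-InOrbit d)
    (σ-orbit-trans (σ-orbit-sym (base-orbit _)) (σ-orbit-trans (vertex-orbit d) (base-orbit d)))

  dart-vertex-InOrbit : ∀ {d} → InOrbit d → dart (vertex d) ≡ d
  dart-vertex-InOrbit {d} p = trans (dart-vertex d) (cong (λ k → iter s (toℕ k) d) (shift-unique zero p))

  vertex-dart : ∀ v → vertex (dart v) ≡ v
  vertex-dart v = proj₂ (proj₂ vertices) _ _
    (σ-orbit-trans (vertex-orbit (dart v)) (σ-orbit-sym (base-orbit (r v))))

  dart-injective : ∀ {u v} → dart u ≡ dart v → u ≡ v
  dart-injective {u} {v} eq = trans (sym (vertex-dart u)) (trans (cong vertex eq) (vertex-dart v))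

  word : Fin V → Word
  word v = proj₁ (base-InOrbit (r v))

  act-word : ∀ v → act (word v) d₀ ≡ dart v
  act-word v = proj₂ (base-InOrbit (r v))

  -- The group law on the vertices

  infixl 6 _⊕_
  -- The translation orbit of `d₀` is identified with the vertices through `dart`; the translation
  -- taking `d₀` to `dart u` is applied to `dart v`.
  _⊕_ : Fin V → Fin V → Fin V
  u ⊕ v = vertex (act (word u) (dart v))

  ⊖_ : Fin V → Fin V
  ⊖ u = vertex (act (inverse (word u)) d₀)

  𝟘 : Fin V
  𝟘 = vertex d₀

  dart-𝟘 : dart 𝟘 ≡ d₀
  dart-𝟘 = dart-vertex-InOrbit ([] , refl)

  dart-⊖ : ∀ u → dart (⊖ u) ≡ act (inverse (word u)) d₀
  dart-⊖ u = dart-vertex-InOrbit (inverse (word u) , refl)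

  dart-⊕ : ∀ u v → dart (u ⊕ v) ≡ act (word u) (dart v)
  dart-⊕ u v = dart-vertex-InOrbit (act-InOrbit (word u) (base-InOrbit (r v)))

  ⊕-comm : ∀ u v → u ⊕ v ≡ v ⊕ u
  ⊕-comm u v = dart-injective (begin
    dart (u ⊕ v)                   ≡⟨ dart-⊕ u v ⟩
    act (word u) (dart v)          ≡⟨ cong (act (word u)) (act-word v) ⟨
    act (word u) (act (word v) d₀) ≡⟨ act-comm (word u) (word v) d₀ ⟩
    act (word v) (act (word u) d₀) ≡⟨ cong (act (word v)) (act-word u) ⟩
    act (word v) (dart u)          ≡⟨ dart-⊕ v u ⟨
    dart (v ⊕ u)                   ∎)

  -- Independence of the chosen `word u`: as translations commute, the image of `d₀` under a
  -- translation determines its effect on the whole orbit.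
  dart-⊕-act : ∀ {u} v w → act w d₀ ≡ dart u → dart (u ⊕ v) ≡ act w (dart v)
  dart-⊕-act {u} v w eq = begin
    dart (u ⊕ v)            ≡⟨ cong dart (⊕-comm u v) ⟩
    dart (v ⊕ u)            ≡⟨ dart-⊕ v u ⟩
    act (word v) (dart u)   ≡⟨ cong (act (word v)) eq ⟨
    act (word v) (act w d₀) ≡⟨ act-comm (word v) w d₀ ⟩
    act w (act (word v) d₀) ≡⟨ cong (act w) (act-word v) ⟩
    act w (dart v)          ∎

  ⊕-assoc : ∀ u v w → (u ⊕ v) ⊕ w ≡ u ⊕ (v ⊕ w)
  ⊕-assoc u v w = dart-injective (begin
    dart ((u ⊕ v) ⊕ w)
      -- The concatenation also leads from `d₀` to `dart (u ⊕ v)`, though it may differ from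
      -- `word (u ⊕ v)`.
      ≡⟨ dart-⊕-act {u ⊕ v} w (word u ++ word v)
           (trans (act-++ (word u) (word v) d₀)
             (trans (cong (act (word u)) (act-word v)) (sym (dart-⊕ u v)))) ⟩
    act (word u ++ word v) (dart w)      ≡⟨ act-++ (word u) (word v) _ ⟩
    act (word u) (act (word v) (dart w)) ≡⟨ cong (act (word u)) (dart-⊕ v w) ⟨
    act (word u) (dart (v ⊕ w))          ≡⟨ dart-⊕ u (v ⊕ w) ⟨
    dart (u ⊕ (v ⊕ w))                   ∎)

  ⊕-identityˡ : ∀ v → 𝟘 ⊕ v ≡ v
  ⊕-identityˡ v = dart-injective (dart-⊕-act v [] (sym dart-𝟘))

  ⊕-inverseʳ : ∀ v → v ⊕ ⊖ v ≡ 𝟘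
  ⊕-inverseʳ v = dart-injective (begin
    dart (v ⊕ ⊖ v)                           ≡⟨ dart-⊕ v (⊖ v) ⟩
    act (word v) (dart (⊖ v))                ≡⟨ cong (act (word v)) (dart-⊖ v) ⟩
    act (word v) (act (inverse (word v)) d₀) ≡⟨ act-inverse (word v) d₀ ⟩
    d₀                                       ≡⟨ dart-𝟘 ⟨
    dart 𝟘                                   ∎)

  translationGroup : FinAbGroup V
  translationGroup = record
    { _+ᴳ_ = _⊕_
    ; 0ᴳ = 𝟘
    ; -ᴳ_ = ⊖_
    ; isAbelianGroup = record
      { isGroup = record
        { isMonoid = record
          { isSemigroup = record
            { isMagma = record { isEquivalence = isEquivalence ; ∙-cong = cong₂ _⊕_ }
            ; assoc = ⊕-assoc
            }
          ; identity = comm∧idˡ⇒id ⊕-comm ⊕-identityˡ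
          }
        ; inverse = comm∧invʳ⇒inv ⊕-comm ⊕-inverseʳ
        ; ⁻¹-cong = cong ⊖_
        }
      ; comm = ⊕-comm
      }
    }

  -- Generation by two translations

  translation : Letter → Fin V
  translation l = vertex (⟦ l ⟧ d₀)

  vertex-act : ∀ l w → vertex (act (l ∷ w) d₀) ≡ translation l ⊕ vertex (act w d₀)
  vertex-act l w = dart-injective (begin
    dart (vertex (act (l ∷ w) d₀))          ≡⟨ dart-vertex-InOrbit (l ∷ w , refl) ⟩
    ⟦ l ⟧ (act w d₀)                        ≡⟨ cong ⟦ l ⟧ (dart-vertex-InOrbit (w , refl)) ⟨
    ⟦ l ⟧ (dart (vertex (act w d₀)))
      ≡⟨ dart-⊕-act _ (l ∷ []) (sym (dart-vertex-InOrbit (l ∷ [] , refl))) ⟨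
    dart (translation l ⊕ vertex (act w d₀)) ∎)

  open AbelianGroup (toAbelianGroup translationGroup) using (commutativeSemigroup)
  open AbelianGroupProperties (toAbelianGroup translationGroup)
    using (⁻¹-∙-comm; inverseʳ-unique)
  open CommutativeSemigroupProperties commutativeSemigroup using (interchange; x∙yz≈y∙xz)

  -- abc = 1 read in the group.
  translation-c : translation c ≡ (⊖ translation a) ⊕ (⊖ translation b)
  translation-c = trans (inverseʳ-unique (translation a ⊕ translation b) (translation c) (begin
    (translation a ⊕ translation b) ⊕ translation c  ≡⟨ ⊕-assoc (translation a) (translation b) (translation c) ⟩
    translation a ⊕ (translation b ⊕ translation c)  ≡⟨ cong (translation a ⊕_) (vertex-act b (c ∷ [])) ⟨
    translation a ⊕ vertex (act (b ∷ c ∷ []) d₀)     ≡⟨ vertex-act a (b ∷ c ∷ []) ⟨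
    vertex (act (a ∷ b ∷ c ∷ []) d₀)                 ≡⟨ cong vertex (abc d₀) ⟩
    𝟘                                                ∎))
    (sym (⁻¹-∙-comm (translation a) (translation b)))

  private
    _·_ : ℤ → Fin V → Fin V
    _·_ = zmul translationGroup

  -- Letter by letter, `a` raises the first coefficient, `b` raises the second, and `c` = -a - b
  -- lowers both.
  act-combination : ∀ w → ∃[ i ] ∃[ j ] vertex (act w d₀) ≡ (i · translation a) ⊕ (j · translation b)
  act-combination [] = + 0 , + 0 , sym (⊕-identityˡ 𝟘)
  act-combination (l ∷ w) with act-combination w
  act-combination (a ∷ w) | i , j , eq = sucℤ i , j , (begin
    vertex (act (a ∷ w) d₀)                               ≡⟨ vertex-act a w ⟩
    A ⊕ vertex (act w d₀)                                 ≡⟨ cong (A ⊕_) eq ⟩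
    A ⊕ ((i · A) ⊕ (j · B))                               ≡⟨ ⊕-assoc A (i · A) (j · B) ⟨
    (A ⊕ (i · A)) ⊕ (j · B)                               ≡⟨ cong (_⊕ (j · B)) (zmul-suc translationGroup i A) ⟨
    (sucℤ i · A) ⊕ (j · B)                                ∎)
    where
    A = translation a
    B = translation b
  act-combination (b ∷ w) | i , j , eq = i , sucℤ j , (begin
    vertex (act (b ∷ w) d₀)                               ≡⟨ vertex-act b w ⟩
    B ⊕ vertex (act w d₀)                                 ≡⟨ cong (B ⊕_) eq ⟩
    B ⊕ ((i · A) ⊕ (j · B))                               ≡⟨ x∙yz≈y∙xz B (i · A) (j · B) ⟩
    (i · A) ⊕ (B ⊕ (j · B))                               ≡⟨ cong ((i · A) ⊕_) (zmul-suc translationGroup j B) ⟨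
    (i · A) ⊕ (sucℤ j · B)                                ∎)
    where
    A = translation a
    B = translation b
  act-combination (c ∷ w) | i , j , eq = predℤ i , predℤ j , (begin
    vertex (act (c ∷ w) d₀)                               ≡⟨ vertex-act c w ⟩
    translation c ⊕ vertex (act w d₀)                     ≡⟨ cong₂ _⊕_ translation-c eq ⟩
    ((⊖ A) ⊕ (⊖ B)) ⊕ ((i · A) ⊕ (j · B))                 ≡⟨ interchange (⊖ A) (⊖ B) (i · A) (j · B) ⟩
    ((⊖ A) ⊕ (i · A)) ⊕ ((⊖ B) ⊕ (j · B))
      ≡⟨ cong₂ _⊕_ (zmul-pred translationGroup i A) (zmul-pred translationGroup j B) ⟨
    (predℤ i · A) ⊕ (predℤ j · B)                         ∎)
    where
    A = translation a
    B = translation b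

  translations-generate : GeneratedBy2 translationGroup (translation a) (translation b)
  translations-generate v =
    let i , j , eq = act-combination (word v) in
    i , j , trans (sym (trans (cong vertex (act-word v)) (vertex-dart v))) eq

  -- The isomorphism with the Cayley sum graph

  connectionSet : Fin 3 → Fin V
  connectionSet k = vertex (halfTurn k d₀)

  -- A half-turn inverts translations, so it takes w d₀ to w⁻¹ applied to its value at `d₀`;
  -- additively, u goes to its value at 0 minus u.
  dart-reflect : ∀ k u → dart (connectionSet k ⊕ ⊖ u) ≡ halfTurn k (dart u)
  dart-reflect k u = begin
    dart (connectionSet k ⊕ ⊖ u)                 ≡⟨ cong dart (⊕-comm (connectionSet k) (⊖ u)) ⟩
    dart (⊖ u ⊕ connectionSet k)                 ≡⟨ dart-⊕-act (connectionSet k) (inverse (word u)) (sym (dart-⊖ u)) ⟩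
    act (inverse (word u)) (dart (connectionSet k))
      ≡⟨ cong (act (inverse (word u))) (dart-vertex-InOrbit (halfTurn-InOrbit k)) ⟩
    act (inverse (word u)) (halfTurn k d₀)       ≡⟨ halfTurn-act k (word u) d₀ ⟨
    halfTurn k (act (word u) d₀)                 ≡⟨ cong (halfTurn k) (act-word u) ⟩
    halfTurn k (dart u)                          ∎

  base-α : ∀ d → iter s (toℕ (shift d)) (t d) ≡ dart (connectionSet (shift d) ⊕ ⊖ vertex d)
  base-α d = begin
    iter s (toℕ (shift d)) (t d)                   ≡⟨ σ^-α (shift d) d ⟩
    halfTurn (shift d) (base d)                    ≡⟨ cong (halfTurn (shift d)) (dart-vertex d) ⟨
    halfTurn (shift d) (dart (vertex d))           ≡⟨ dart-reflect (shift d) (vertex d) ⟨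
    dart (connectionSet (shift d) ⊕ ⊖ vertex d)    ∎

  -- By `base-α` the index of `d` also takes `t d` into the orbit, and that index is unique.
  shift-α : ∀ d → shift (t d) ≡ shift d
  shift-α d = shift-unique (shift d) (subst InOrbit (sym (base-α d)) (base-InOrbit _))

  vertex-α : ∀ d → vertex (t d) ≡ connectionSet (shift d) ⊕ ⊖ vertex d
  vertex-α d = dart-injective (begin
    dart (vertex (t d))                         ≡⟨ dart-vertex (t d) ⟩
    base (t d)                                  ≡⟨ cong (λ k → iter s (toℕ k) (t d)) (shift-α d) ⟩
    iter s (toℕ (shift d)) (t d)                ≡⟨ base-α d ⟩
    dart (connectionSet (shift d) ⊕ ⊖ vertex d) ∎)

  cayleyDart : Fin n → Fin V × Fin 3
  cayleyDart d = vertex d , shift d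

  cayleyDart-injective : Injective _≡_ _≡_ cayleyDart
  -- The vertex determines the dart of the orbit there, and equal shifts reach it by the same power
  -- of σ, which is injective.
  cayleyDart-injective {d} {e} eq = iter-injective (σ-inj M) (toℕ (shift d)) (begin
    base d                   ≡⟨ dart-vertex d ⟨
    dart (vertex d)          ≡⟨ cong (λ p → dart (proj₁ p)) eq ⟩
    dart (vertex e)          ≡⟨ dart-vertex e ⟩
    base e                   ≡⟨ cong (λ p → iter s (toℕ (proj₂ p)) e) eq ⟨
    iter s (toℕ (shift d)) e ∎)

  σ^-inverse : ∀ k d → ∃[ e ] iter s (toℕ {3} k) e ≡ d
  σ^-inverse zero             d = d , refl
  σ^-inverse (suc zero)       d = s (s d) , s³ d
  σ^-inverse (suc (suc zero)) d = s d , s³ d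

  cayleyDart-surjective : ∀ p → ∃[ d ] cayleyDart d ≡ p
  cayleyDart-surjective (v , k) =
    let d , eq = σ^-inverse k (dart v) in
    d , cong₂ _,_ (trans (orbit⇒vertex (toℕ k , eq)) (vertex-dart v))
          (shift-unique k (subst InOrbit (sym eq) (base-InOrbit (r v))))

  isoToCayleySum : IsoToCayleySum M translationGroup connectionSet
  isoToCayleySum = cayleyDart
    , ( cayleyDart-injective
      , λ p → let d , eq = cayleyDart-surjective p in d , λ z≡d → trans (cong cayleyDart z≡d) eq)
    , (λ d → cong₂ _,_ (vertex-α d) (shift-α d))
    , λ d e → mk⇔ orbit⇒vertex vertex⇒orbit

theorem3 : ∀ {n} (M : Map n) → Is036Fullerene M →
    ∃[ N ] Σ (FinAbGroup N) λ G →
    (∃[ a ] ∃[ b ] GeneratedBy2 G a b) ×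
    (∃[ k ] Σ (Fin k → Fin N) λ S → IsoToCayleySum M G S)
theorem3 M fullerene =
  _ , translationGroup M fullerene
    , (_ , _ , translations-generate M fullerene)
    , (3 , connectionSet M fullerene , isoToCayleySum M fullerene)
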